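{- Let $(S,+)$ be an infinite left weakly cancellative semigroup with no idempotent element, and let $A\subseteq S$ be an IP set. Then there is a family $\{A_\alpha:\alpha<2^\omega\}$ of subsets of $A$ such that each $A_\alpha$ is an infinite IP set and $A_\alpha\cap A_\beta$ is finite whenever $\alpha<\beta<2^\omega$.
   Context: $S$ is left weakly cancellative if for all $a,b\in S$ the set $\{x: a+x=b\}$ is finite; $e$ is idempotent if $e+e=e$. For a sequence $\langle x_n\rangle_{n=1}^\infty$ in $S$, $\mathrm{FS}(\langle x_n\rangle_{n=1}^\infty)$ is the set of all sums $\sum_{n\in H}x_n$ (in increasing order of indices) with $H$ a nonempty finite subset of $\mathbb{N}$. $A$ is an IP set if $\mathrm{FS}(\langle x_n\rangle_{n=1}^\infty)\subseteq A$ for some sequence $\langle x_n\rangle_{n=1}^\infty$ in $S$. -}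

module Defs where

open import Algebra.Bundles using (Semigroup)
open import Data.List.Base using (List)
import Data.List.Membership.Setoid as Membership
open import Data.List.NonEmpty.Base using (List⁺; toList; map; foldr₁)
open import Data.List.Relation.Unary.Linked using (Linked)
open import Data.Nat.Base using (ℕ; _<_)
open import Data.Product.Base using (∃; _×_)
open import Function.Bundles using (_⇔_)
open import Level using (Level; _⊔_)
open import Relation.Nullary.Negation.Core using (¬_)
open import Relation.Unary using (Pred; _⊆_)

private
  variable
    p : Level

-- The semigroup operation, additive in ordinary notation, is the bundle's _∙_.
-- A subset of S is a predicate on the carrier that respects _≈_.
module _ {c ℓ : Level} (S : Semigroup c ℓ) where

  open Semigroup S
  open Membership setoid using (_∈_)

  -- P = {s₁, …, sₖ}, repetitions allowed.
  Finite : Pred Carrier p → Set (c ⊔ ℓ ⊔ p)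
  Finite P = ∃ λ (xs : List Carrier) → ∀ s → P s ⇔ s ∈ xs

  Infinite : Pred Carrier p → Set (c ⊔ ℓ ⊔ p)
  Infinite P = ¬ Finite P

  LeftWeaklyCancellative : Set (c ⊔ ℓ)
  LeftWeaklyCancellative = ∀ a b → Finite (λ x → a ∙ x ≈ b)

  -- A nonempty finite set H of indices is given by its strictly increasing
  -- list of elements, so the sum is taken in increasing order of indices.
  -- Sequences are indexed from 0.
  FS : (ℕ → Carrier) → Pred Carrier ℓ
  FS x s = ∃ λ (H : List⁺ ℕ) → Linked _<_ (toList H) × s ≈ foldr₁ _∙_ (map x H)

  IsIP : Pred Carrier p → Set (c ⊔ ℓ ⊔ p)
  IsIP A = ∃ λ (x : ℕ → Carrier) → FS x ⊆ A

{-# OPTIONS --safe #-}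

-- Since no element is idempotent, the multiples of an element are pairwise
-- distinct. Hence no tail set FS(x_m, x_{m+1}, …) is contained in a finite set:
-- otherwise some value would occur infinitely often among the x_n, and all of
-- its multiples would lie in that tail set. By left weak cancellativity one can
-- therefore choose successive block sums y_n of x such that neither y_n nor any
-- t + y_n with t ∈ FS(y_0, …, y_{n-1}) belongs to FS(y_0, …, y_{n-1}). The value
-- of a finite sum of y then determines its largest index. Coding the finite
-- prefixes of binary sequences by natural numbers, let A_α be the set of finite
-- sums of the y_n with n a code of a prefix of α. If α and β differ at k, a
-- common element of A_α and A_β has as largest index the code of a common
-- prefix, so it is one of the finitely many sums up to the code of α's prefix of
-- length k.
module Submission where

open import Algebra.Bundles using (Semigroup)
open import Algebra.Definitions using (_IdempotentOn_)
open import Axiom.DoubleNegationElimination using (em⇒dne)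
open import Axiom.ExcludedMiddle using (ExcludedMiddle)
open import Data.Bool.Base using (Bool; true; false)
open import Data.List.Base using (List; []; _∷_; _++_; map; concatMap; filter)
import Data.List.Membership.Setoid as Membership
import Data.List.Membership.Setoid.Properties as Mem
open import Data.List.NonEmpty.Base as List⁺ using (_∷_; foldr₁)
import Data.List.NonEmpty.Properties as List⁺
open import Data.List.Relation.Unary.Any as Any using (here; there)
import Data.List.Relation.Unary.Any.Properties as Any
open import Data.List.Relation.Unary.Linked using (Linked; [-]; _∷_)
open import Data.Nat.Base
  using (ℕ; zero; suc; _+_; _*_; _∸_; _⊔_; _≤_; _<_; z≤n; s≤s; s≤s⁻¹)
open import Data.Nat.Properties
open import Data.Product.Base using (∃; ∃₂; _×_; _,_; proj₁; proj₂)
open import Data.Sum.Base using (inj₁; inj₂)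
open import Function.Base using (_∘_)
open import Function.Bundles using (module Equivalence; mk⇔)
open import Level using (Level; Lift; lift)
open import Relation.Binary.Definitions using (_Respects_; tri<; tri≈; tri>)
open import Relation.Binary.PropositionalEquality as ≡ using (_≡_; _≢_; _≗_)
open import Relation.Nullary.Decidable using (yes; no; True; toWitness; fromWitness)
open import Relation.Nullary.Negation.Core using (¬_; contradiction)
open import Relation.Unary using (Pred; Decidable; U; _⊆_; _∩_; _≐_)
open import Defs

monotone : (b : ℕ → ℕ) → (∀ i → b i ≤ b (suc i)) → ∀ {m n} → m ≤ n → b m ≤ b n
monotone b step {n = zero}  z≤n   = ≤-refl
monotone b step {n = suc n} m≤1+n with m≤n⇒m<n∨m≡n m≤1+n
... | inj₁ m<1+n  = ≤-trans (monotone b step (s≤s⁻¹ m<1+n)) (step n)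
... | inj₂ ≡.refl = ≤-refl

-- Codes of prefixes of binary sequences.

bit : Bool → ℕ
bit false = 0
bit true  = 1

bit+2*-injective : ∀ a b {m n} → bit a + 2 * m ≡ bit b + 2 * n → a ≡ b × m ≡ n
bit+2*-injective false false         eq = ≡.refl , *-cancelˡ-≡ _ _ 2 eq
bit+2*-injective false true  {m} {n} eq = contradiction eq (even≢odd m n)
bit+2*-injective true  false {m} {n} eq = contradiction (≡.sym eq) (even≢odd n m)
bit+2*-injective true  true          eq = ≡.refl , *-cancelˡ-≡ _ _ 2 (suc-injective eq)

-- The code of the prefix of α of length n (bijective base 2).
branch : (ℕ → Bool) → ℕ → ℕ
branch α zero    = 0
branch α (suc n) = suc (bit (α n) + 2 * branch α n)

branch-cong : ∀ {α β} → α ≗ β → branch α ≗ branch β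
branch-cong α≗β zero    = ≡.refl
branch-cong α≗β (suc n) =
  ≡.cong₂ (λ a m → suc (bit a + 2 * m)) (α≗β n) (branch-cong α≗β n)

branch-< : ∀ α n → branch α n < branch α (suc n)
branch-< α n = s≤s (≤-trans (m≤n*m (branch α n) 2) (m≤n+m _ (bit (α n))))

-- Only the empty prefix has code 0. From any other code, subtract one: parity gives the last digit
-- and halving gives the code of the remaining prefix.
branch-injective : ∀ α β i j → branch α i ≡ branch β j →
                   i ≡ j × (∀ k → k < i → α k ≡ β k)
branch-injective α β zero    zero    eq = ≡.refl , λ _ ()
branch-injective α β (suc i) (suc j) eq
  with bit+2*-injective (α i) (β j) (suc-injective eq)
... | αi≡βj , eq′ with branch-injective α β i j eq′
... | ≡.refl , agree = ≡.refl , agree′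
  where
  agree′ : ∀ k → k < suc i → α k ≡ β k
  agree′ k k<1+i with m<1+n⇒m<n∨m≡n k<1+i
  ... | inj₁ k<i    = agree k k<i
  ... | inj₂ ≡.refl = αi≡βj

module _ {c ℓ : Level} (S : Semigroup c ℓ) where

  open Semigroup S
  open Membership setoid using (_∈_; _∉_)

  -- Multiples of an element.

  -- pow s n is the sum of n + 1 copies of s.
  pow : Carrier → ℕ → Carrier
  pow s zero    = s
  pow s (suc n) = pow s n ∙ s

  pow-∙ : ∀ s m n → pow s m ∙ pow s n ≈ pow s (suc (m + n))
  pow-∙ s m zero    rewrite +-identityʳ m = refl
  pow-∙ s m (suc n) rewrite +-suc m n =
    trans (sym (assoc _ _ _)) (∙-congʳ (pow-∙ s m n))

  module _ (no-idempotent : ∀ e → ¬ (_IdempotentOn_ _≈_ _∙_ e)) where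

    -- If pow s has period p = d + 1 from i on, then any n ≥ i with n + 1 a
    -- multiple of p gives the idempotent pow s n.
    pow-distinct : ∀ s i d → ¬ (pow s i ≈ pow s (suc d + i))
    pow-distinct s i d eq =
      no-idempotent (pow s n) (trans (pow-∙ s n n) (sym (periods (suc i) n i≤n)))
      where
      -- Chosen so that `suc i * suc d` is `suc n`: after `suc i` periods the exponent is
      -- `suc (n + n)`, as in `pow-∙`.
      n = d + i * suc d

      i≤n : i ≤ n
      i≤n = ≤-trans (m≤m*n i (suc d)) (m≤n+m _ d)

      period : ∀ n → i ≤ n → pow s n ≈ pow s (suc d + n)
      period n i≤n with m≤n⇒m<n∨m≡n i≤n
      period n       _ | inj₂ ≡.refl = eq
      period (suc n) _ | inj₁ i<1+n rewrite +-suc d n =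
        ∙-congʳ (period n (s≤s⁻¹ i<1+n))

      periods : ∀ q n → i ≤ n → pow s n ≈ pow s (q * suc d + n)
      periods zero    n i≤n = refl
      periods (suc q) n i≤n rewrite +-assoc d (q * suc d) n =
        trans (periods q n i≤n) (period _ (≤-trans i≤n (m≤n+m n (q * suc d))))

    pow-injective-< : ∀ s {i j} → i < j → ¬ (pow s i ≈ pow s j)
    pow-injective-< s {i} {j} i<j eq = pow-distinct s i (j ∸ suc i)
      (≡.subst (λ k → pow s i ≈ pow s k) j≡ eq)
      where
      j≡ : j ≡ suc (j ∸ suc i) + i
      j≡ = ≡.trans (≡.sym (m∸n+n≡m i<j)) (+-suc (j ∸ suc i) i)

  -- Finite sums over intervals of indices.

  -- Sum x m n s: s is a sum of x over a nonempty finite set of indices in [m, n).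
  data Sum (x : ℕ → Carrier) (m n : ℕ) (s : Carrier) : Set (c Level.⊔ ℓ) where
    single : ∀ {i} → m ≤ i → i < n → s ≈ x i → Sum x m n s
    snoc   : ∀ {i t} → Sum x m i t → i < n → s ≈ t ∙ x i → Sum x m n s

  module _ {x : ℕ → Carrier} where

    Sum-resp : ∀ {m n s t} → s ≈ t → Sum x m n t → Sum x m n s
    Sum-resp s≈t (single m≤i i<n t≈) = single m≤i i<n (trans s≈t t≈)
    Sum-resp s≈t (snoc r i<n t≈)     = snoc r i<n (trans s≈t t≈)

    Sum-mono : ∀ {m m′ n n′ s} → m′ ≤ m → n ≤ n′ → Sum x m n s → Sum x m′ n′ s
    Sum-mono m′≤m n≤n′ (single m≤i i<n s≈) =
      single (≤-trans m′≤m m≤i) (<-≤-trans i<n n≤n′) s≈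
    Sum-mono m′≤m n≤n′ (snoc r i<n s≈) =
      snoc (Sum-mono m′≤m ≤-refl r) (<-≤-trans i<n n≤n′) s≈

    Sum⇒< : ∀ {m n s} → Sum x m n s → m < n
    Sum⇒< (single m≤i i<n _) = ≤-<-trans m≤i i<n
    Sum⇒< (snoc r i<n _)     = <-trans (Sum⇒< r) i<n

    Sum-∙ : ∀ {k m n s t} → Sum x k m s → Sum x m n t → Sum x k n (s ∙ t)
    Sum-∙ r (single m≤i i<n t≈) = snoc (Sum-mono ≤-refl m≤i r) i<n (∙-congˡ t≈)
    Sum-∙ r (snoc r′ i<n t≈)    =
      snoc (Sum-∙ r r′) i<n (trans (∙-congˡ t≈) (sym (assoc _ _ _)))

    -- `Sum` grows at its largest index, while lists and `foldr₁` grow at the front; the list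
    -- `i ∷ is` accumulates the larger indices already peeled off.
    Sum⇒FS-∙ : ∀ {m n s} → Sum x m n s → ∀ i is → n ≤ i → Linked _<_ (i ∷ is) →
               FS S x (s ∙ foldr₁ _∙_ (List⁺.map x (i ∷ is)))
    Sum⇒FS-∙ (single {j} _ j<n s≈) i is n≤i i∷is =
      (j ∷ i ∷ is) , (<-≤-trans j<n n≤i ∷ i∷is) , ∙-congʳ s≈
    Sum⇒FS-∙ (snoc {j} r j<n s≈) i is n≤i i∷is
      with Sum⇒FS-∙ r j (i ∷ is) ≤-refl (<-≤-trans j<n n≤i ∷ i∷is)
    ... | H , linked , eq =
      H , linked , trans (trans (∙-congʳ s≈) (assoc _ _ _)) eq

    Sum⇒FS : ∀ {m n s} → Sum x m n s → FS S x s
    Sum⇒FS (single {i} _ _ s≈) = (i ∷ []) , [-] , s≈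
    Sum⇒FS (snoc {i} r _ s≈) with Sum⇒FS-∙ r i [] ≤-refl [-]
    ... | H , linked , eq = H , linked , trans s≈ eq

    FS⇒Sum : ∀ {s} → FS S x s → ∃ λ n → Sum x 0 n s
    FS⇒Sum (i ∷ is , linked , s≈) with go i is linked
      where
      go : ∀ i is → Linked _<_ (i ∷ is) →
           ∃ λ n → Sum x i n (foldr₁ _∙_ (List⁺.map x (i ∷ is)))
      go i []       [-]             = suc i , single ≤-refl ≤-refl refl
      go i (j ∷ is) (i<j ∷ linked) with go j is linked
      ... | n , r = n , Sum-∙ (single ≤-refl i<j refl) r
    ... | n , r = n , Sum-resp s≈ (Sum-mono z≤n ≤-refl r)

  -- Successive blocks occupy disjoint intervals in increasing order, so the index sets concatenate.
  Sum-blocks : ∀ {x z} (b : ℕ → ℕ) → (∀ i → Sum x (b i) (b (suc i)) (z i)) →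
               ∀ {m n s} → Sum z m n s → Sum x (b m) (b n) s
  Sum-blocks {x} {z} b block = go
    where
    b-mono : ∀ {m n} → m ≤ n → b m ≤ b n
    b-mono = monotone b (λ i → <⇒≤ (Sum⇒< (block i)))

    go : ∀ {m n s} → Sum z m n s → Sum x (b m) (b n) s
    go (single m≤i i<n s≈) =
      Sum-resp s≈ (Sum-mono (b-mono m≤i) (b-mono i<n) (block _))
    go (snoc r i<n s≈) =
      Sum-resp s≈ (Sum-mono ≤-refl (b-mono i<n) (Sum-∙ (go r) (block _)))

  FS-resp : ∀ x → FS S x Respects _≈_
  FS-resp x s≈t (H , linked , s≈) = H , linked , trans (sym s≈t) s≈

  FS-cong : ∀ {x y} → x ≗ y → FS S x ⊆ FS S y
  FS-cong x≗y (H , linked , s≈) =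
    H , linked , trans s≈ (reflexive (≡.cong (foldr₁ _∙_) (List⁺.map-cong x≗y H)))

  -- Sums outside a finite list.

  module _ (em : ∀ {q} → ExcludedMiddle q) where

    Finite-⊆ : ∀ {p} {P : Pred Carrier p} → P Respects _≈_ →
               ∀ L → (∀ {s} → P s → s ∈ L) → Finite S P
    Finite-⊆ {P = P} resp L P⊆L = filter P? L , λ s → mk⇔
      (λ Ps → Mem.∈-filter⁺ setoid P? resp (P⊆L Ps) Ps)
      (λ s∈ → proj₂ (Mem.∈-filter⁻ setoid P? resp {xs = L} s∈))
      where
      P? : Decidable P
      P? _ = em

    -- Pigeonhole by induction on `L`: either the head `a` recurs, or it is avoided from some `N` on
    -- and the terms from `m ⊔ N` on lie in the tail.
    recurrent-value : ∀ L m (x : ℕ → Carrier) → (∀ n → m ≤ n → x n ∈ L) →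
                      ∃ λ s → ∀ N → ∃ λ n → N ≤ n × s ≈ x n
    recurrent-value []      m x x∈L with () ← x∈L m ≤-refl
    recurrent-value (a ∷ L) m x x∈L
      with em {P = ∃ λ N → ∀ n → N ≤ n → ¬ (x n ≈ a)}
    ... | yes (N , x≉a) = recurrent-value L (m ⊔ N) x λ n m⊔N≤n →
            Any.tail (x≉a n (m⊔n≤o⇒n≤o m N m⊔N≤n)) (x∈L n (m⊔n≤o⇒m≤o m N m⊔N≤n))
    ... | no ¬x≉a = a , λ N → em⇒dne em λ ¬∃ →
            ¬x≉a (N , λ n N≤n xn≈a → ¬∃ (n , N≤n , sym xn≈a))

    module _ (no-idempotent : ∀ e → ¬ (_IdempotentOn_ _≈_ _∙_ e)) where

      pow-not-covered : ∀ s L → ¬ (∀ n → pow s n ∈ L)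
      pow-not-covered s L pow∈L
        with recurrent-value L 0 (pow s) (λ n _ → pow∈L n)
      ... | t , recur with recur 0
      ... | i , _ , t≈i with recur (suc i)
      ... | j , i<j , t≈j =
        pow-injective-< no-idempotent s i<j (trans (sym t≈i) t≈j)

      sum-outside : ∀ x m L → ∃₂ λ n s → Sum x m n s × s ∉ L
      sum-outside x m L = em⇒dne em λ none →
        let
          covered : ∀ {n s} → Sum x m n s → s ∈ L
          covered r = em⇒dne em λ s∉L → none (_ , _ , r , s∉L)
          s , recur = recurrent-value L m x
            (λ n m≤n → covered (single m≤n ≤-refl refl))
        in pow-not-covered s L (covered ∘ proj₂ ∘ pow-sum recur)
        where
        -- Each further copy of `s` is found at an index beyond all those used before.
        pow-sum : ∀ {s} → (∀ N → ∃ λ n → N ≤ n × s ≈ x n) →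
                  ∀ k → ∃ λ n → Sum x m n (pow s k)
        pow-sum recur zero with recur m
        ... | i , m≤i , s≈ = suc i , single m≤i ≤-refl s≈
        pow-sum recur (suc k) with pow-sum recur k
        ... | n , r with recur n
        ... | i , n≤i , s≈ = suc i , snoc (Sum-mono ≤-refl n≤i r) ≤-refl (∙-congˡ s≈)

      FS-infinite : ∀ {p} {P : Pred Carrier p} x → FS S x ⊆ P → Infinite S P
      FS-infinite x FS⊆P (L , P⇔L) with sum-outside x 0 L
      ... | _ , s , r , s∉L = s∉L (Equivalence.to (P⇔L s) (FS⊆P (Sum⇒FS r)))

      -- Block sums whose finite sums determine their largest index.

      module Subsystem (lwc : LeftWeaklyCancellative S) (x : ℕ → Carrier) where

        -- Left weak cancellativity makes the solutions `s` of `a ∙ s ≈ b` with `a`, `b` in `L` a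
        -- finite list, which the next block sum can avoid.
        quotients : List Carrier → List Carrier
        quotients L = concatMap (λ a → concatMap (λ b → proj₁ (lwc a b)) L) L

        ∈-quotients : ∀ {L a b s} → a ∈ L → b ∈ L → b ≈ a ∙ s → s ∈ quotients L
        ∈-quotients a∈L b∈L b≈as =
          Any.concatMap⁺ _ (Any.map (λ a≈a′ →
            Any.concatMap⁺ _ (Any.map (λ b≈b′ →
              Equivalence.to (proj₂ (lwc _ _) _)
                (trans (∙-congʳ (sym a≈a′)) (trans (sym b≈as) b≈b′))) b∈L)) a∈L)

        next : ∀ m L → ∃₂ λ n s → Sum x m n s × s ∉ L ++ quotients L
        next m L = sum-outside x m (L ++ quotients L)

        -- The choices need not unfold later: the properties proved inside this block suffice.
        opaque
          bound : ℕ → ℕ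
          -- sums n lists FS(y_0, …, y_{n-1}).
          sums  : ℕ → List Carrier
          y     : ℕ → Carrier

          y n = proj₁ (proj₂ (next (bound n) (sums n)))

          bound zero    = 0
          bound (suc n) = proj₁ (next (bound n) (sums n))

          sums zero    = []
          sums (suc n) = sums n ++ y n ∷ map (_∙ y n) (sums n)

          y-block : ∀ n → Sum x (bound n) (bound (suc n)) (y n)
          y-block n = proj₁ (proj₂ (proj₂ (next (bound n) (sums n))))

          y-avoids : ∀ n → y n ∉ sums n ++ quotients (sums n)
          y-avoids n = proj₂ (proj₂ (proj₂ (next (bound n) (sums n))))

          sums-old : ∀ {n s} → s ∈ sums n → s ∈ sums (suc n)
          sums-old = Any.++⁺ˡ

          sums-single : ∀ {n s} → s ≈ y n → s ∈ sums (suc n)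
          sums-single {n} s≈ = Any.++⁺ʳ (sums n) (here s≈)

          sums-snoc : ∀ {n s t} → t ∈ sums n → s ≈ t ∙ y n → s ∈ sums (suc n)
          sums-snoc {n} t∈ s≈ = Any.++⁺ʳ (sums n) (there (Any.map⁺
            (Any.map (λ t≈t′ → trans s≈ (∙-congʳ t≈t′)) t∈)))

        sums-mono : ∀ {m n s} → m ≤ n → s ∈ sums m → s ∈ sums n
        sums-mono {n = zero}  z≤n   s∈ = s∈
        sums-mono {n = suc n} m≤1+n s∈ with m≤n⇒m<n∨m≡n m≤1+n
        ... | inj₁ m<1+n  = sums-old (sums-mono (s≤s⁻¹ m<1+n) s∈)
        ... | inj₂ ≡.refl = s∈

        -- The stage at which a value first appears stands in for its largest index, independently
        -- of how it is written as a sum.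
        New : ℕ → Pred Carrier _
        New n s = s ∈ sums (suc n) × s ∉ sums n

        new-single : ∀ {n s} → s ≈ y n → New n s
        new-single {n} s≈ =
          sums-single s≈ ,
          λ s∈ → y-avoids n (Any.++⁺ˡ (Mem.∈-resp-≈ setoid s≈ s∈))

        -- Were `s` already in `sums n`, then `y n` would solve `t ∙ y n ≈ s` within that list and
        -- be one of its quotients.
        new-snoc : ∀ {n s t} → t ∈ sums n → s ≈ t ∙ y n → New n s
        new-snoc {n} t∈ s≈ =
          sums-snoc t∈ s≈ ,
          λ s∈ → y-avoids n (Any.++⁺ʳ (sums n) (∈-quotients t∈ s∈ s≈))

        new-unique : ∀ {m n s} → New m s → New n s → m ≡ n
        new-unique {m} {n} (s∈m , s∉m) (s∈n , s∉n) with <-cmp m n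
        ... | tri< m<n _ _ = contradiction (sums-mono m<n s∈m) s∉n
        ... | tri≈ _ m≡n _ = m≡n
        ... | tri> _ _ n<m = contradiction (sums-mono n<m s∈n) s∉m

        Sum⇒∈sums : ∀ {n s} → Sum y 0 n s → s ∈ sums n
        Sum⇒∈sums (single _ i<n s≈) = sums-mono i<n (proj₁ (new-single s≈))
        Sum⇒∈sums (snoc r i<n s≈)   =
          sums-mono i<n (proj₁ (new-snoc (Sum⇒∈sums r) s≈))

        -- Subsequences along binary branches.

        yᵇ : (ℕ → Bool) → ℕ → Carrier
        yᵇ α = y ∘ branch α

        yᵇ-block : ∀ α i → Sum y (branch α i) (branch α (suc i)) (yᵇ α i)
        yᵇ-block α i = single ≤-refl (branch-< α i) refl

        yᵇ-FS⊆ : ∀ α → FS S (yᵇ α) ⊆ FS S x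
        yᵇ-FS⊆ α s∈ = Sum⇒FS (Sum-blocks bound y-block
          (Sum-blocks (branch α) (yᵇ-block α) (proj₂ (FS⇒Sum s∈))))

        FS⇒New : ∀ α {s} → FS S (yᵇ α) s → ∃ λ i → New (branch α i) s
        FS⇒New α s∈ with FS⇒Sum s∈
        ... | _ , single {i} _ _ s≈ = i , new-single s≈
        ... | _ , snoc {i} r _ s≈   =
          i , new-snoc (Sum⇒∈sums (Sum-blocks (branch α) (yᵇ-block α) r)) s≈

        FS-common : ∀ α β k → α k ≢ β k → ∀ {s} → FS S (yᵇ α) s → FS S (yᵇ β) s →
                    s ∈ sums (suc (branch α k))
        FS-common α β k αk≢βk s∈α s∈β with FS⇒New α s∈α | FS⇒New β s∈β
        ... | i , new-i | j , new-j =
          sums-mono (s≤s (monotone (branch α) (λ n → <⇒≤ (branch-< α n)) i≤k))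
            (proj₁ new-i)
          where
          i≤k : i ≤ k
          -- Equal codes come from equal prefixes, and a prefix of length above `k` would include
          -- the position where `α` and `β` differ.
          i≤k = ≮⇒≥ λ k<i →
            αk≢βk (proj₂ (branch-injective α β i j (new-unique new-i new-j)) k k<i)

theorem2p5 : (∀ {q} → ExcludedMiddle q) →
    ∀ {c ℓ p} (S : Semigroup c ℓ) → let open Semigroup S in
    Infinite S U →
    LeftWeaklyCancellative S →
    (∀ e → ¬ (_IdempotentOn_ _≈_ _∙_ e)) →
    (A : Pred Carrier p) → A Respects _≈_ → IsIP S A →
    ∃ λ (F : (ℕ → Bool) → Pred Carrier p) →
    (∀ α → F α Respects _≈_) ×
    (∀ α β → α ≗ β → F α ≐ F β) ×
    (∀ α → F α ⊆ A) ×
    (∀ α → Infinite S (F α) × IsIP S (F α)) ×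
    (∀ α β → ¬ (α ≗ β) → Finite S (F α ∩ F β))
theorem2p5 em {p = p} S _ lwc no-idempotent A _ (x , FS⊆A) =
  F , F-resp , (λ α β α≗β → F-mono α≗β , F-mono (≡.sym ∘ α≗β)) ,
  (λ α → FS⊆A ∘ yᵇ-FS⊆ α ∘ F⇒FS) ,
  (λ α → FS-infinite S em no-idempotent (yᵇ α) FS⇒F , yᵇ α , FS⇒F) ,
  F-almost-disjoint
  where
  open Semigroup S
  open Subsystem S em no-idempotent lwc x

  -- Excluded middle moves FS S (yᵇ α) into the universe level of A.
  F : (ℕ → Bool) → Pred Carrier p
  F α s = Lift p (True (em {P = FS S (yᵇ α) s}))

  F⇒FS : ∀ {α} → F α ⊆ FS S (yᵇ α)
  F⇒FS (lift s∈) = toWitness s∈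

  FS⇒F : ∀ {α} → FS S (yᵇ α) ⊆ F α
  FS⇒F s∈ = lift (fromWitness s∈)

  F-resp : ∀ α → F α Respects _≈_
  F-resp α s≈t = FS⇒F ∘ FS-resp S (yᵇ α) s≈t ∘ F⇒FS

  F-mono : ∀ {α β} → α ≗ β → F α ⊆ F β
  F-mono α≗β = FS⇒F ∘ FS-cong S (≡.cong y ∘ branch-cong α≗β) ∘ F⇒FS

  F-almost-disjoint : ∀ α β → ¬ (α ≗ β) → Finite S (F α ∩ F β)
  F-almost-disjoint α β α≇β = Finite-⊆ S em
    (λ s≈t (s∈α , s∈β) → F-resp α s≈t s∈α , F-resp β s≈t s∈β)
    (sums (suc (branch α (proj₁ difference))))
    (λ (s∈α , s∈β) →
      FS-common α β _ (proj₂ difference) (F⇒FS s∈α) (F⇒FS s∈β))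
    where
    difference : ∃ λ k → α k ≢ β k
    difference = em⇒dne em λ none → α≇β λ k →
      em⇒dne em λ αk≢βk → none (k , αk≢βk)
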